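{- Let $X$ be a finite set of elements of a metric space with metric $d$, let $k\in\mathbb{Z}^+$ with $|X|\ge k$, and let $\varepsilon\in(0,1)$. Algorithm SDM (defined in the context), run on $X$ presented as a stream in any order with parameters $\varepsilon$ and $k$, is a $\frac{1-\varepsilon}{2}$-approximation algorithm for max-min diversity maximization: it returns a set $S\subseteq X$ with $|S|=k$ and $$div(S)\ \ge\ \frac{1-\varepsilon}{2}\cdot \mathtt{OPT},\qquad \mathtt{OPT}=\max_{T\subseteq X,\ |T|=k} div(T).$$
   Context: For $S\subseteq X$, $div(S)=\min_{x,y\in S,\,x\ne y}d(x,y)$, and for $x\in X$, $d(x,S)=\min_{y\in S}d(x,y)$; a minimum over the empty set is $+\infty$. Let $d_{min}=\min_{x,y\in X,\,x\neq y}d(x,y)$ and $d_{max}=\max_{x,y\in X}d(x,y)$. The max-min diversity maximization problem asks for $S\subseteq X$ with $|S|=k$ maximizing $div(S)$. Algorithm SDM (Streaming Diversity Maximization). Let $\mathcal{U}=\{\frac{d_{min}}{(1-\varepsilon)^j} : j\in\mathbb{Z}_{\ge 0},\ \frac{d_{min}}{(1-\varepsilon)^j}\in[d_{min},d_{max}]\}$. Initialize $S_\mu=\emptyset$ for each $\mu\in\mathcal{U}$. For each arriving $x\in X$ (one pass) and each $\mu\in\mathcal{U}$: if $|S_\mu|<k$ and $d(x,S_\mu)\ge\mu$, set $S_\mu\leftarrow S_\mu\cup\{x\}$. After the stream ends, return $S=\arg\max_{\mu\in\mathcal{U}:\,|S_\mu|=k}div(S_\mu)$, i.e. a candidate $S_\mu$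 of size $k$ with largest diversity.
   Formalization: That the algorithm returns a set is claimed only for |X| ≥ 2: if |X| = 1, then d_min = +∞ and d_max = 0, so the set of guesses U is empty and the algorithm as defined has no output. -}

module Defs where

open import Algebra.Bundles using (CommutativeRing; Semiring)
import Algebra.Definitions.RawSemiring as RawSemiringDefinitions
open import Data.Fin.Base using (Fin)
import Data.Fin.Properties as Fin
open import Data.Fin.Subset using (Subset; inside; outside; _∈_; _∪_; ⁅_⁆; ∣_∣; ⊥; ⊤)
open import Data.Fin.Subset.Properties using (_∈?_)
open import Data.List.Base
  using (List; []; _∷_; _++_; map; filter; foldl; allFin; cartesianProduct)
import Data.List.Extrema as Extrema
import Data.List.Membership.Propositional as List
open import Data.List.Membership.Propositional.Properties using (∈-map⁺; ∈-++⁺ˡ; ∈-++⁺ʳ)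
open import Data.List.Relation.Unary.Any using (here)
open import Data.Nat.Base as ℕ using (ℕ; zero; suc)
import Data.Nat.Properties as ℕ
open import Data.Product.Base using (∃-syntax; _×_; _,_; uncurry)
import Data.Vec.Base as Vec
open import Function.Metric.Structures using (IsGeneralMetric)
open import Level using (Level; _⊔_) renaming (suc to lsuc)
open import Relation.Binary.Bundles using (DecTotalOrder)
open import Relation.Binary.Core using (Rel)
open import Relation.Binary.Structures using (IsDecTotalOrder)
import Relation.Binary.Construct.Add.Supremum.NonStrict as AddSupremum
import Relation.Binary.Construct.NonStrictToStrict as NonStrictToStrict
open import Relation.Binary.PropositionalEquality.Core using (_≡_; refl)
open import Relation.Nullary.Construct.Add.Supremum using (_⁺; ⊤⁺; [_])
open import Relation.Nullary.Decidable using (Dec; does; _×-dec_; ¬?)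
open import Relation.Nullary.Negation using (¬_)
open import Data.Bool.Base using (if_then_else_)

-- The scalars. Classically, ℝ is an instance; completeness is not required.
record ArchimedeanOrderedField c ℓ₁ ℓ₂ : Set (lsuc (c ⊔ ℓ₁ ⊔ ℓ₂)) where
  field
    commutativeRing : CommutativeRing c ℓ₁

  open CommutativeRing commutativeRing public
  open RawSemiringDefinitions (Semiring.rawSemiring semiring) public using (_^_) renaming (_×_ to _×ₙ_)

  infix  4 _≤_
  infix  8 _⁻¹
  infixl 7 _/_

  field
    _≤_             : Rel Carrier ℓ₂
    isDecTotalOrder : IsDecTotalOrder _≈_ _≤_
    +-monoˡ-≤       : ∀ z {x y} → x ≤ y → x + z ≤ y + z
    *-nonNegative   : ∀ {x y} → 0# ≤ x → 0# ≤ y → 0# ≤ x * y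
    0≉1             : ¬ 0# ≈ 1#
    -- Total, with an unspecified value at 0#.
    _⁻¹             : Carrier → Carrier
    *-inverseʳ      : ∀ x → ¬ x ≈ 0# → x * x ⁻¹ ≈ 1#
    archimedean     : ∀ x → ∃[ n ] x ≤ n ×ₙ 1#

  decTotalOrder : DecTotalOrder c ℓ₁ ℓ₂
  decTotalOrder = record { isDecTotalOrder = isDecTotalOrder }

  open DecTotalOrder decTotalOrder public using (totalOrder; _≤?_)
  open NonStrictToStrict _≈_ _≤_ public using (_<_)

  _/_ : Carrier → Carrier → Carrier
  x / y = x * y ⁻¹

  2# : Carrier
  2# = 1# + 1#

record MetricSpace {c ℓ₁ ℓ₂} (K : ArchimedeanOrderedField c ℓ₁ ℓ₂) m ℓ
  : Set (c ⊔ ℓ₁ ⊔ ℓ₂ ⊔ lsuc (m ⊔ ℓ)) where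
  private module K = ArchimedeanOrderedField K
  infix 4 _≈_
  field
    Carrier  : Set m
    _≈_      : Rel Carrier ℓ
    d        : Carrier → Carrier → K.Carrier
    isMetric : IsGeneralMetric _≈_ K._≈_ K._≤_ K.0# K._+_ d

module Extended {c ℓ₁ ℓ₂} (K : ArchimedeanOrderedField c ℓ₁ ℓ₂) where
  open ArchimedeanOrderedField K
  open AddSupremum _≤_ public using (_≤⁺_; ≤⁺-dec; ≤⁺-isDecTotalOrder)

  infix  4 _≤⁺?_
  infixr 7 _·⁺_
  infixl 7 _/⁺_

  decTotalOrder⁺ : DecTotalOrder c (c ⊔ ℓ₁) (c ⊔ ℓ₂)
  decTotalOrder⁺ = record { isDecTotalOrder = ≤⁺-isDecTotalOrder isDecTotalOrder }

  open DecTotalOrder decTotalOrder⁺ public using () renaming (totalOrder to totalOrder⁺)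

  _≤⁺?_ : (x y : Carrier ⁺) → Dec (x ≤⁺ y)
  _≤⁺?_ = ≤⁺-dec _≤?_

  -- Scaling fixes +∞, so these are only meaningful for positive scalars.
  _·⁺_ : Carrier → Carrier ⁺ → Carrier ⁺
  a ·⁺ [ x ] = [ a * x ]
  a ·⁺ ⊤⁺    = ⊤⁺

  _/⁺_ : Carrier ⁺ → Carrier → Carrier ⁺
  [ x ] /⁺ a = [ x / a ]
  ⊤⁺    /⁺ a = ⊤⁺

  min⁺ : List (Carrier ⁺) → Carrier ⁺
  min⁺ = Extrema.min totalOrder⁺ ⊤⁺

  -- The base value [ 0# ] is harmless: this is only applied to distances and
  -- diversities, which are nonnegative.
  max⁺ : List (Carrier ⁺) → Carrier ⁺
  max⁺ = Extrema.max totalOrder⁺ [ 0# ]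

subsets : ∀ n → List (Subset n)
subsets zero    = Vec.[] ∷ []
subsets (suc n) = map (outside Vec.∷_) (subsets n) ++ map (inside Vec.∷_) (subsets n)

∈-subsets : ∀ {n} (S : Subset n) → S List.∈ subsets n
∈-subsets Vec.[]              = here refl
∈-subsets (outside Vec.∷ S)   = ∈-++⁺ˡ (∈-map⁺ (outside Vec.∷_) (∈-subsets S))
∈-subsets {suc n} (inside Vec.∷ S) =
  ∈-++⁺ʳ (map (outside Vec.∷_) (subsets n)) (∈-map⁺ (inside Vec.∷_) (∈-subsets S))

-- X is the image of an enumeration of n points (which is assumed injective
-- where it matters), and subsets of X are sets of indices.
module Diversity
  {c ℓ₁ ℓ₂ m ℓ} (K : ArchimedeanOrderedField c ℓ₁ ℓ₂) (M : MetricSpace K m ℓ)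
  {n : ℕ} (point : Fin n → MetricSpace.Carrier M)
  where
  open ArchimedeanOrderedField K
  open Extended K

  dist : Fin n → Fin n → Carrier ⁺
  dist i j = [ MetricSpace.d M (point i) (point j) ]

  pairs : List (Fin n × Fin n)
  pairs = cartesianProduct (allFin n) (allFin n)

  div : Subset n → Carrier ⁺
  div S = min⁺ (map (uncurry dist) (filter distinctIn? pairs))
    where
    distinctIn? : ((i , j) : Fin n × Fin n) → Dec (i ∈ S × j ∈ S × ¬ i ≡ j)
    distinctIn? (i , j) = i ∈? S ×-dec j ∈? S ×-dec ¬? (i Fin.≟ j)

  distTo : Fin n → Subset n → Carrier ⁺
  distTo i S = min⁺ (map (dist i) (filter (_∈? S) (allFin n)))

  dmin : Carrier ⁺
  dmin = div ⊤

  dmax : Carrier ⁺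
  dmax = max⁺ (map (uncurry dist) pairs)

  OPT : ℕ → Carrier ⁺
  OPT k = max⁺ (map div (filter (λ T → ∣ T ∣ ℕ.≟ k) (subsets n)))

  module SDM (k : ℕ) (ε : Carrier) where

    data 𝒰 : Carrier ⁺ → Set (c ⊔ ℓ₂) where
      guess : (j : ℕ) → let μ = dmin /⁺ ((1# - ε) ^ j) in
              dmin ≤⁺ μ → μ ≤⁺ dmax → 𝒰 μ

    update : Carrier ⁺ → Subset n → Fin n → Subset n
    update μ S i =
      if does (∣ S ∣ ℕ.<? k ×-dec μ ≤⁺? distTo i S) then S ∪ ⁅ i ⁆ else S

    -- The candidates for different μ do not interact, so each is computed by
    -- its own fold over the stream.
    candidate : List (Fin n) → Carrier ⁺ → Subset n
    candidate stream μ = foldl (update μ) ⊥ stream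

    -- A relation rather than a function, since ties in the final argmax may be
    -- broken arbitrarily. There is no output when no candidate has size k.
    record Returns (stream : List (Fin n)) (S : Subset n) : Set (c ⊔ ℓ₂) where
      field
        μ         : Carrier ⁺
        μ∈𝒰       : 𝒰 μ
        S≡Sμ      : S ≡ candidate stream μ
        ∣Sμ∣≡k    : ∣ candidate stream μ ∣ ≡ k
        maximal   : ∀ {ν} → 𝒰 ν → ∣ candidate stream ν ∣ ≡ k →
                    div (candidate stream ν) ≤⁺ div (candidate stream μ)

-- Every point outside an unfilled candidate S_μ lies within μ of it, and |S_μ| < k,
-- so any k points contain two sharing a nearest centre: OPT ≤ 2μ. A filled
-- candidate has div(S_μ) ≥ μ. The candidate for d_min is always filled, so there
-- is a guess μ ≤ d_max with a filled candidate whose successor μ/(1−ε) either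
-- exceeds d_max or has an unfilled candidate. In both cases OPT ≤ 2μ/(1−ε), whence
-- div(S) ≥ div(S_μ) ≥ μ ≥ (1−ε)/2 · OPT. For k = 1 every candidate of size k
-- has diversity +∞.
module Submission where

open import Defs
open import Data.Fin.Base using (Fin)
open import Data.Fin.Subset using (Subset; ∣_∣)
open import Data.List.Base using (List; allFin)
open import Data.List.Relation.Binary.Permutation.Propositional using (_↭_)
open import Data.Nat.Base as ℕ using (ℕ)
open import Data.Product.Base using (∃; _×_)
open import Function.Definitions using (Injective)
open import Level using (Level)
open import Relation.Binary.PropositionalEquality.Core using (_≡_)

import Algebra.Properties.CommutativeSemigroup as CommutativeSemigroupProperties
import Algebra.Properties.Ring as RingProperties
import Algebra.Properties.Semiring.Mult as SemiringMult
open import Data.Bool.Base using (if_then_else_)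
import Data.Fin.Base as Fin
import Data.Fin.Properties as Fin
open import Data.Fin.Subset using (inside; outside; _∈_; _⊆_; _∪_; ⁅_⁆; ⊥; ⊤)
  renaming (_-_ to _∖_)
open import Data.Fin.Subset.Properties
open import Data.List.Base using ([]; _∷_; filter; foldl; map; upTo)
import Data.List.Extrema as Extrema
import Data.List.Membership.Propositional as List
open import Data.List.Membership.Propositional.Properties
  using (∈-allFin; ∈-cartesianProduct⁺; ∈-filter⁺; ∈-filter⁻; ∈-map⁺; ∈-map⁻; ∈-upTo⁺)
open import Data.List.Relation.Binary.Permutation.Propositional using (↭-sym)
open import Data.List.Relation.Binary.Permutation.Propositional.Properties using (∈-resp-↭)
import Data.List.Relation.Unary.All as All
import Data.List.Relation.Unary.All.Properties as All
open import Data.List.Relation.Unary.Any using (here; there)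
open import Data.Nat.Base using (zero; suc; s≤s)
import Data.Nat.Properties as ℕ
open import Data.Product.Base using (∃-syntax; _,_; proj₁; proj₂; uncurry)
open import Data.Sum.Base using (_⊎_; inj₁; inj₂)
import Data.Vec.Base as Vec
open import Function.Base using (_∘_)
open import Function.Metric.Structures using (IsGeneralMetric; IsSemiMetric)
open import Relation.Binary.Bundles using (DecTotalOrder)
open import Relation.Binary.PropositionalEquality.Core as ≡ using (_≢_; cong; subst; subst₂)
import Relation.Binary.Reasoning.PartialOrder as ≤-Reasoning
import Relation.Binary.Reasoning.Setoid as ≈-Reasoning
open import Relation.Nullary.Construct.Add.Supremum using (_⁺; ⊤⁺; [_])
open import Relation.Binary.Construct.Add.Supremum.NonStrict as AddSupremum
  using (_≤⊤⁺)
  renaming ([_] to [_]≤⁺)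
open import Relation.Nullary.Decidable
  using (Dec; yes; no; does; _×-dec_; ¬?; decidable-stable)
open import Relation.Nullary.Negation using (¬_; contradiction)
open import Relation.Unary using (Decidable)

-- Ordered field arithmetic.

module OrderedFieldProperties {c ℓ₁ ℓ₂} (K : ArchimedeanOrderedField c ℓ₁ ℓ₂) where
  open ArchimedeanOrderedField K
  open DecTotalOrder decTotalOrder public
    using (poset; total; antisym; ≤-respˡ-≈; ≤-respʳ-≈)
    renaming (refl to ≤-refl; trans to ≤-trans; reflexive to ≤-reflexive)
  open RingProperties ring
  open CommutativeSemigroupProperties *-commutativeSemigroup using (x∙yz≈y∙xz)
  open SemiringMult semiring using (×-assoc-*; ×-congʳ)

  +-monoʳ-≤ : ∀ z {x y} → x ≤ y → z + x ≤ z + y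
  +-monoʳ-≤ z {x} {y} x≤y =
    ≤-respˡ-≈ (+-comm x z) (≤-respʳ-≈ (+-comm y z) (+-monoˡ-≤ z x≤y))

  +-mono-≤ : ∀ {w x y z} → w ≤ x → y ≤ z → w + y ≤ x + z
  +-mono-≤ w≤x y≤z = ≤-trans (+-monoˡ-≤ _ w≤x) (+-monoʳ-≤ _ y≤z)

  x≤y⇒0≤y-x : ∀ {x y} → x ≤ y → 0# ≤ y - x
  x≤y⇒0≤y-x {x} x≤y = ≤-respˡ-≈ (-‿inverseʳ x) (+-monoˡ-≤ (- x) x≤y)

  0≤y-x⇒x≤y : ∀ {x y} → 0# ≤ y - x → x ≤ y
  0≤y-x⇒x≤y {x} {y} 0≤y-x =
    ≤-respˡ-≈ (+-identityˡ x) (≤-respʳ-≈ (//-rightDividesˡ x y) (+-monoˡ-≤ x 0≤y-x))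

  *-monoˡ-≤ : ∀ {x y z} → 0# ≤ z → x ≤ y → z * x ≤ z * y
  *-monoˡ-≤ {x} {y} {z} 0≤z x≤y =
    0≤y-x⇒x≤y (≤-respʳ-≈ (x[y-z]≈xy-xz z y x) (*-nonNegative 0≤z (x≤y⇒0≤y-x x≤y)))

  *-monoʳ-≤ : ∀ {x y z} → 0# ≤ z → x ≤ y → x * z ≤ y * z
  *-monoʳ-≤ {x} {y} {z} 0≤z x≤y =
    ≤-respˡ-≈ (*-comm z x) (≤-respʳ-≈ (*-comm z y) (*-monoˡ-≤ 0≤z x≤y))

  0≤1 : 0# ≤ 1#
  0≤1 with total 0# 1#
  ... | inj₁ 0≤1 = 0≤1
  ... | inj₂ 1≤0 = ≤-respʳ-≈ square (*-nonNegative 0≤-1 0≤-1)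
    where
    0≤-1 : 0# ≤ - 1#
    0≤-1 = ≤-respʳ-≈ (+-identityˡ (- 1#)) (x≤y⇒0≤y-x 1≤0)
    square : - 1# * - 1# ≈ 1#
    square = trans (-1*x≈-x (- 1#)) (-‿involutive 1#)

  1≰0 : ¬ 1# ≤ 0#
  1≰0 1≤0 = 0≉1 (antisym 0≤1 1≤0)

  1≤2 : 1# ≤ 2#
  1≤2 = ≤-respˡ-≈ (+-identityˡ 1#) (+-monoˡ-≤ 1# 0≤1)

  2≉0 : ¬ 2# ≈ 0#
  2≉0 2≈0 = 1≰0 (≤-respʳ-≈ 2≈0 1≤2)

  -- The field axioms state no congruence for `_⁻¹`, so identities between inverses are reached by
  -- exhibiting an inverse and appealing to its uniqueness.
  ⁻¹-unique : ∀ {x y} → ¬ x ≈ 0# → x * y ≈ 1# → y ≈ x ⁻¹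
  ⁻¹-unique {x} {y} x≉0 xy≈1 = begin
    y               ≈⟨ *-identityʳ y ⟨
    y * 1#          ≈⟨ *-congˡ (*-inverseʳ x x≉0) ⟨
    y * (x * x ⁻¹)  ≈⟨ x∙yz≈y∙xz y x (x ⁻¹) ⟩
    x * (y * x ⁻¹)  ≈⟨ *-assoc x y (x ⁻¹) ⟨
    x * y * x ⁻¹    ≈⟨ *-congʳ xy≈1 ⟩
    1# * x ⁻¹       ≈⟨ *-identityˡ (x ⁻¹) ⟩
    x ⁻¹            ∎
    where open ≈-Reasoning setoid

  *-nonZero : ∀ {x y} → ¬ x ≈ 0# → ¬ y ≈ 0# → ¬ x * y ≈ 0#
  *-nonZero {x} {y} x≉0 y≉0 xy≈0 = y≉0 (begin
    y               ≈⟨ *-identityʳ y ⟨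
    y * 1#          ≈⟨ *-congˡ (*-inverseʳ x x≉0) ⟨
    y * (x * x ⁻¹)  ≈⟨ x∙yz≈y∙xz y x (x ⁻¹) ⟩
    x * (y * x ⁻¹)  ≈⟨ *-assoc x y (x ⁻¹) ⟨
    x * y * x ⁻¹    ≈⟨ *-congʳ xy≈0 ⟩
    0# * x ⁻¹       ≈⟨ zeroˡ (x ⁻¹) ⟩
    0#              ∎)
    where open ≈-Reasoning setoid

  ⁻¹-nonNegative : ∀ {x} → 0# ≤ x → ¬ x ≈ 0# → 0# ≤ x ⁻¹
  ⁻¹-nonNegative {x} 0≤x x≉0 with total 0# (x ⁻¹)
  ... | inj₁ 0≤x⁻¹ = 0≤x⁻¹
  ... | inj₂ x⁻¹≤0 =
    contradiction (≤-respˡ-≈ (*-inverseʳ x x≉0) (≤-respʳ-≈ (zeroʳ x) (*-monoˡ-≤ 0≤x x⁻¹≤0))) 1≰0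

  x/2*[y+y]≈x*y : ∀ x y → x / 2# * (y + y) ≈ x * y
  x/2*[y+y]≈x*y x y = begin
    x * 2# ⁻¹ * (y + y)    ≈⟨ *-assoc x (2# ⁻¹) (y + y) ⟩
    x * (2# ⁻¹ * (y + y))  ≈⟨ *-congˡ (*-congˡ (+-cong (*-identityˡ y) (*-identityˡ y))) ⟨
    x * (2# ⁻¹ * (1# * y + 1# * y)) ≈⟨ *-congˡ (*-congˡ (distribʳ y 1# 1#)) ⟨
    x * (2# ⁻¹ * (2# * y)) ≈⟨ *-congˡ (*-assoc (2# ⁻¹) 2# y) ⟨
    x * (2# ⁻¹ * 2# * y)   ≈⟨ *-congˡ (*-congʳ (trans (*-comm (2# ⁻¹) 2#) (*-inverseʳ 2# 2≉0))) ⟩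
    x * (1# * y)           ≈⟨ *-congˡ (*-identityˡ y) ⟩
    x * y                  ∎
    where open ≈-Reasoning setoid

  -- Apply the axiom to `y / x` and multiply back by `x`.
  archimedean-* : ∀ {x} → 0# < x → ∀ y → ∃[ n ] y ≤ n ×ₙ x
  archimedean-* {x} (0≤x , 0≉x) y with n , y/x≤n ← archimedean (y / x) = n , (begin
    y                ≈⟨ *-identityʳ y ⟨
    y * 1#           ≈⟨ *-congˡ (*-inverseʳ x (λ x≈0 → 0≉x (sym x≈0))) ⟨
    y * (x * x ⁻¹)   ≈⟨ x∙yz≈y∙xz y x (x ⁻¹) ⟩
    x * (y * x ⁻¹)   ≈⟨ *-comm x (y / x) ⟩
    y / x * x        ≤⟨ *-monoʳ-≤ 0≤x y/x≤n ⟩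
    (n ×ₙ 1#) * x    ≈⟨ ×-assoc-* n 1# x ⟩
    n ×ₙ (1# * x)    ≈⟨ ×-congʳ n (*-identityˡ x) ⟩
    n ×ₙ x           ∎)
    where open ≤-Reasoning poset

  0<x*y : ∀ {x y} → 0# < x → 0# < y → 0# < x * y
  0<x*y (0≤x , 0≉x) (0≤y , 0≉y) =
    *-nonNegative 0≤x 0≤y ,
    λ 0≈xy → *-nonZero (λ x≈0 → 0≉x (sym x≈0)) (λ y≈0 → 0≉y (sym y≈0)) (sym 0≈xy)

  -- Growth of the geometric progression of guesses.

  module GeometricProgression {ε : Carrier} (0<ε : 0# < ε) (ε<1 : ε < 1#) where

    private
      a : Carrier
      a = 1# - ε

    0≤a : 0# ≤ a
    0≤a = x≤y⇒0≤y-x (proj₁ ε<1)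

    a≉0 : ¬ a ≈ 0#
    a≉0 a≈0 = proj₂ ε<1 (sym (x∙y⁻¹≈ε⇒x≈y 1# ε a≈0))

    0≤a^ : ∀ j → 0# ≤ a ^ j
    0≤a^ zero    = 0≤1
    0≤a^ (suc j) = *-nonNegative 0≤a (0≤a^ j)

    a^≉0 : ∀ j → ¬ a ^ j ≈ 0#
    a^≉0 zero    = λ 1≈0 → 0≉1 (sym 1≈0)
    a^≉0 (suc j) = *-nonZero a≉0 (a^≉0 j)

    level : Carrier → ℕ → Carrier
    level δ j = δ / a ^ j

    level-zero : ∀ δ → level δ 0 ≈ δ
    level-zero δ = trans
      (*-congˡ (sym (⁻¹-unique (a^≉0 0) (*-identityʳ 1#)))) (*-identityʳ δ)

    a*level-suc : ∀ δ j → a * level δ (suc j) ≈ level δ j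
    a*level-suc δ j = trans (x∙yz≈y∙xz a δ _) (*-congˡ (⁻¹-unique (a^≉0 j) (begin
      a ^ j * (a * (a * a ^ j) ⁻¹)  ≈⟨ x∙yz≈y∙xz (a ^ j) a _ ⟩
      a * (a ^ j * (a * a ^ j) ⁻¹)  ≈⟨ *-assoc a (a ^ j) _ ⟨
      a * a ^ j * (a * a ^ j) ⁻¹    ≈⟨ *-inverseʳ _ (a^≉0 (suc j)) ⟩
      1#                            ∎)))
      where open ≈-Reasoning setoid

    level-nonNegative : ∀ {δ} → 0# ≤ δ → ∀ j → 0# ≤ level δ j
    level-nonNegative 0≤δ j = *-nonNegative 0≤δ (⁻¹-nonNegative (0≤a^ j) (a^≉0 j))

    -- The additive form of `a*level-suc`, obtained from 1 = (1 - ε) + ε. Monotonicity and linear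
    -- growth both read off the increment.
    level-suc : ∀ δ j → level δ (suc j) ≈ level δ j + ε * level δ (suc j)
    level-suc δ j = begin
      x                        ≈⟨ *-identityˡ x ⟨
      1# * x                   ≈⟨ *-congʳ (//-rightDividesˡ ε 1#) ⟨
      (a + ε) * x              ≈⟨ distribʳ x a ε ⟩
      a * x + ε * x            ≈⟨ +-congʳ (a*level-suc δ j) ⟩
      level δ j + ε * x        ∎
      where
      open ≈-Reasoning setoid
      x = level δ (suc j)

    level-mono-suc : ∀ {δ} → 0# ≤ δ → ∀ j → level δ j ≤ level δ (suc j)
    level-mono-suc {δ} 0≤δ j = begin
      level δ j                          ≈⟨ +-identityʳ _ ⟨
      level δ j + 0#                     ≤⟨ +-monoʳ-≤ _ 0≤ε*level ⟩
      level δ j + ε * level δ (suc j)    ≈⟨ level-suc δ j ⟨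
      level δ (suc j)                    ∎
      where
      open ≤-Reasoning poset
      0≤ε*level : 0# ≤ ε * level δ (suc j)
      0≤ε*level = *-nonNegative (proj₁ 0<ε) (level-nonNegative 0≤δ (suc j))

    level-mono : ∀ {δ} → 0# ≤ δ → ∀ {i j} → i ℕ.≤′ j → level δ i ≤ level δ j
    level-mono 0≤δ ℕ.≤′-refl          = ≤-refl
    level-mono 0≤δ (ℕ.≤′-step {j} i≤′j) = ≤-trans (level-mono 0≤δ i≤′j) (level-mono-suc 0≤δ j)

    δ≤level : ∀ {δ} → 0# ≤ δ → ∀ j → δ ≤ level δ j
    δ≤level {δ} 0≤δ zero    = ≤-reflexive (sym (level-zero δ))
    δ≤level     0≤δ (suc j) = ≤-trans (δ≤level 0≤δ j) (level-mono-suc 0≤δ j)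

    -- A Bernoulli-type bound: every increment is ε times a level, and every level is at least δ.
    level-linear : ∀ {δ} → 0# ≤ δ → ∀ j → j ×ₙ (ε * δ) + δ ≤ level δ j
    level-linear {δ} 0≤δ zero    = ≤-reflexive (trans (+-identityˡ δ) (sym (level-zero δ)))
    level-linear {δ} 0≤δ (suc j) = begin
      ε * δ + j ×ₙ (ε * δ) + δ         ≈⟨ +-assoc _ _ δ ⟩
      ε * δ + (j ×ₙ (ε * δ) + δ)       ≈⟨ +-comm _ _ ⟩
      j ×ₙ (ε * δ) + δ + ε * δ         ≤⟨ +-mono-≤ (level-linear 0≤δ j) εδ≤ε*level ⟩
      level δ j + ε * level δ (suc j)  ≈⟨ level-suc δ j ⟨
      level δ (suc j)                  ∎
      where
      open ≤-Reasoning poset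
      εδ≤ε*level : ε * δ ≤ ε * level δ (suc j)
      εδ≤ε*level = *-monoˡ-≤ (proj₁ 0<ε) (δ≤level 0≤δ (suc j))

    level-unbounded : ∀ {δ} → 0# < δ → ∀ x → ∃[ j ] ¬ level δ j ≤ x
    level-unbounded {δ} 0<δ@(0≤δ , 0≉δ) x with j , x≤jεδ ← archimedean-* (0<x*y 0<ε 0<δ) x =
      -- With jεδ ≥ x the linear bound gives level j ≥ x + δ, so level j ≤ x would force δ ≤ 0.
      j , λ level≤x → 0≉δ (antisym 0≤δ (begin
        δ                                ≈⟨ xyx⁻¹≈y x δ ⟨
        x + δ - x                        ≤⟨ +-monoˡ-≤ (- x) (+-monoˡ-≤ δ x≤jεδ) ⟩
        j ×ₙ (ε * δ) + δ - x             ≤⟨ +-monoˡ-≤ (- x) (≤-trans (level-linear 0≤δ j) level≤x) ⟩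
        x - x                            ≈⟨ -‿inverseʳ x ⟩
        0#                               ∎))
      where open ≤-Reasoning poset

-- Case analysis, finite search and counting in finite subsets.

if-dec-elim : ∀ {a b p} {A : Set a} {B : Set b} {x y : B} (P : B → Set p) (A? : Dec A) →
              (A → P x) → (¬ A → P y) → P (if does A? then x else y)
if-dec-elim P (yes a) then-case else-case = then-case a
if-dec-elim P (no ¬a) then-case else-case = else-case ¬a

-- Search downwards from the failing index; arriving at 0 would contradict `P 0`.
last-before-failure : ∀ {p} {P : ℕ → Set p} → Decidable P → P 0 →
                      ∀ n → ¬ P n → ∃[ j ] P j × ¬ P (suc j)
last-before-failure P? p0 zero    ¬p = contradiction p0 ¬p
last-before-failure P? p0 (suc n) ¬p with P? n
... | yes p = n , p , ¬p
... | no ¬p′ = last-before-failure P? p0 n ¬p′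

∣p∪⁅x⁆∣≤1+∣p∣ : ∀ {n} (p : Subset n) x → ∣ p ∪ ⁅ x ⁆ ∣ ℕ.≤ suc ∣ p ∣
∣p∪⁅x⁆∣≤1+∣p∣ (s Vec.∷ p) (Fin.suc x) with s
... | inside  = s≤s (∣p∪⁅x⁆∣≤1+∣p∣ p x)
... | outside = ∣p∪⁅x⁆∣≤1+∣p∣ p x
∣p∪⁅x⁆∣≤1+∣p∣ (s Vec.∷ p) Fin.zero rewrite ∪-identityʳ p with s
... | inside  = ℕ.n≤1+n _
... | outside = ℕ.≤-refl

2≤∣p∣ : ∀ {n} {p : Subset n} {x y} → x ∈ p → y ∈ p → x ≢ y → 2 ℕ.≤ ∣ p ∣
2≤∣p∣ {p = p} {x} {y} x∈p y∈p x≢y = begin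
  2                ≤⟨ s≤s (ℕ.≤-<-trans ℕ.z≤n (x∈p⇒∣p-x∣<∣p∣ (x∈p∧x≢y⇒x∈p-y y∈p (x≢y ∘ ≡.sym)))) ⟩
  suc ∣ p ∖ x ∣    ≤⟨ x∈p⇒∣p-x∣<∣p∣ x∈p ⟩
  ∣ p ∣            ∎
  where open ℕ.≤-Reasoning

-- Induction on `T`. If its first member collides with a later member, that is the pair; otherwise
-- its image can be deleted from `S`, so both sets shrink and the strict inequality survives.
subset-pigeonhole : ∀ {m n} (T : Subset m) (S : Subset n) (f : Fin m → Fin n) →
                    (∀ {i} → i ∈ T → f i ∈ S) → ∣ S ∣ ℕ.< ∣ T ∣ →
                    ∃[ i ] ∃[ j ] i ∈ T × j ∈ T × i ≢ j × f i ≡ f j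
subset-pigeonhole (outside Vec.∷ T) S f f∈S ∣S∣<∣T∣
  with i , j , i∈T , j∈T , i≢j , fi≡fj ←
         subset-pigeonhole T S (f ∘ Fin.suc) (f∈S ∘ Vec.there) ∣S∣<∣T∣
  = Fin.suc i , Fin.suc j , Vec.there i∈T , Vec.there j∈T , i≢j ∘ Fin.suc-injective , fi≡fj
subset-pigeonhole (inside Vec.∷ T) S f f∈S ∣S∣<∣T∣
  with Fin.any? (λ i → i ∈? T ×-dec f (Fin.suc i) Fin.≟ f Fin.zero)
... | yes (i , i∈T , fi≡f0) =
  Fin.suc i , Fin.zero , Vec.there i∈T , Vec.here , (λ ()) , fi≡f0
... | no f0-unique
  with i , j , i∈T , j∈T , i≢j , fi≡fj ←
         subset-pigeonhole T (S ∖ f Fin.zero) (f ∘ Fin.suc)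
         (λ i∈T → x∈p∧x≢y⇒x∈p-y (f∈S (Vec.there i∈T)) (λ fi≡f0 → f0-unique (_ , i∈T , fi≡f0)))
         (ℕ.<-≤-trans (x∈p⇒∣p-x∣<∣p∣ (f∈S Vec.here)) (ℕ.s≤s⁻¹ ∣S∣<∣T∣))
  = Fin.suc i , Fin.suc j , Vec.there i∈T , Vec.there j∈T , i≢j ∘ Fin.suc-injective , fi≡fj

-- Scalars extended by +∞.

module ExtendedProperties {c ℓ₁ ℓ₂} (K : ArchimedeanOrderedField c ℓ₁ ℓ₂) where
  open ArchimedeanOrderedField K
  open OrderedFieldProperties K
  open Extended K
  open AddSupremum _≤_ public using ([≤]-injective)
  open DecTotalOrder decTotalOrder⁺ public using () renaming (trans to ≤⁺-trans)

  ·⁺-≤ : ∀ {x y z} → 0# ≤ x → y ≤⁺ [ z ] → x ·⁺ y ≤⁺ [ x * z ]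
  ·⁺-≤ 0≤x [ y≤z ]≤⁺ = [ *-monoˡ-≤ 0≤x y≤z ]≤⁺

  max⁺-finite : ∀ xs → (∀ {x} → x List.∈ xs → ∃[ r ] x ≡ [ r ]) → ∃[ r ] max⁺ xs ≡ [ r ]
  max⁺-finite xs finite =
    Extrema.argmax-all totalOrder⁺ (λ x → x) {P = λ x → ∃[ r ] x ≡ [ r ]} (0# , ≡.refl) (All.tabulate finite)

-- Diversity, distance to a set, and the optimum.

module DiversityProperties
  {c ℓ₁ ℓ₂ m ℓ} (K : ArchimedeanOrderedField c ℓ₁ ℓ₂) (M : MetricSpace K m ℓ)
  {n : ℕ} (point : Fin n → MetricSpace.Carrier M)
  where
  open ArchimedeanOrderedField K
  open OrderedFieldProperties K
  open Extended K
  open ExtendedProperties K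
  open Diversity K M point
  open MetricSpace M using (d; isMetric)
  open IsGeneralMetric isMetric using (isSemiMetric; triangle)
  open IsSemiMetric isSemiMetric using (nonNegative; 0⇒≈; ≈⇒0; module EqC)
    renaming (sym to d-sym)

  dist-sym : ∀ {v} i j → v ≤⁺ dist i j → v ≤⁺ dist j i
  dist-sym i j v≤d = ≤⁺-trans v≤d [ ≤-reflexive (d-sym _ _) ]≤⁺

  div-≤ : ∀ {S i j} → i ∈ S → j ∈ S → i ≢ j → div S ≤⁺ dist i j
  div-≤ {S} {i} {j} i∈S j∈S i≢j = All.lookup (Extrema.min≤xs totalOrder⁺ ⊤⁺ _)
    (∈-map⁺ _ (∈-filter⁺ _ (∈-cartesianProduct⁺ (∈-allFin i) (∈-allFin j)) (i∈S , j∈S , i≢j)))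

  -- A list minimum is its base value or is attained. Lower bounds on `div`, positivity of `dmin`
  -- and the +∞ case all follow from this dichotomy.
  div-sel : ∀ S → div S ≡ ⊤⁺ ⊎ ∃[ i ] ∃[ j ] i ∈ S × j ∈ S × i ≢ j × div S ≡ dist i j
  div-sel S with Extrema.argmin-sel totalOrder⁺ (λ x → x) ⊤⁺ _
  ... | inj₁ div≡⊤ = inj₁ div≡⊤
  ... | inj₂ div∈
    with (i , j) , ij∈ , div≡d ← ∈-map⁻ (uncurry dist) div∈
    with _ , i∈S , j∈S , i≢j ← ∈-filter⁻ _ {xs = pairs} ij∈
    = inj₂ (i , j , i∈S , j∈S , i≢j , div≡d)

  div-greatest : ∀ {v S} → (∀ {i j} → i ∈ S → j ∈ S → i ≢ j → v ≤⁺ dist i j) → v ≤⁺ div S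
  div-greatest {v} {S} v≤ with div-sel S
  ... | inj₁ div≡⊤ = subst (v ≤⁺_) (≡.sym div≡⊤) (v ≤⊤⁺)
  ... | inj₂ (_ , _ , i∈S , j∈S , i≢j , div≡d) = subst (v ≤⁺_) (≡.sym div≡d) (v≤ i∈S j∈S i≢j)

  distTo-≤ : ∀ {S i j} → j ∈ S → distTo i S ≤⁺ dist i j
  distTo-≤ {S} {i} {j} j∈S = All.lookup (Extrema.min≤xs totalOrder⁺ ⊤⁺ _)
    (∈-map⁺ (dist i) (∈-filter⁺ (_∈? S) (∈-allFin j) j∈S))

  distTo-greatest : ∀ {v S i} → (∀ {j} → j ∈ S → v ≤⁺ dist i j) → v ≤⁺ distTo i S
  distTo-greatest {v} {S} v≤ = Extrema.v≤min⁺ totalOrder⁺ (v ≤⊤⁺)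
    (All.map⁺ (All.tabulate (λ j∈ → v≤ (proj₂ (∈-filter⁻ (_∈? S) {xs = allFin n} j∈)))))

  -- Distances are decidably comparable and there are finitely many points, so failure of a bound on
  -- the minimum can be traced to a specific member.
  distTo-≰ : ∀ {v S i} → ¬ v ≤⁺ distTo i S → ∃[ j ] j ∈ S × ¬ v ≤⁺ dist i j
  distTo-≰ {v} {S} {i} v≰ with Fin.any? (λ j → j ∈? S ×-dec ¬? (v ≤⁺? dist i j))
  ... | yes found = found
  ... | no ¬found = contradiction
    (distTo-greatest (λ {j} j∈S → decidable-stable (v ≤⁺? dist i j) (λ v≰d → ¬found (j , j∈S , v≰d)))) v≰

  dmax-finite : ∃[ D ] dmax ≡ [ D ]
  dmax-finite = max⁺-finite (map (uncurry dist) pairs) λ x∈ →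
    let _ , _ , x≡d = ∈-map⁻ (uncurry dist) x∈ in _ , x≡d

  dist≤dmax : ∀ i j → dist i j ≤⁺ dmax
  dist≤dmax i j = All.lookup (Extrema.xs≤max totalOrder⁺ [ 0# ] _)
    (∈-map⁺ _ (∈-cartesianProduct⁺ (∈-allFin i) (∈-allFin j)))

  -- The bound `r` must also dominate the base value `[ 0# ]` of `max⁺`, hence the sign condition.
  OPT-≤ : ∀ {k r} → 0# ≤ r → (∀ T → ∣ T ∣ ≡ k → div T ≤⁺ [ r ]) → OPT k ≤⁺ [ r ]
  OPT-≤ {k} 0≤r div≤r = Extrema.max≤v⁺ totalOrder⁺ [ 0≤r ]≤⁺
    (All.map⁺ (All.tabulate λ {T} T∈ →
      div≤r T (proj₂ (∈-filter⁻ (λ T → ∣ T ∣ ℕ.≟ k) {xs = subsets n} T∈))))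

  div-small : ∀ {S} → ∣ S ∣ ℕ.< 2 → div S ≡ ⊤⁺
  div-small {S} ∣S∣<2 with div-sel S
  ... | inj₁ div≡⊤ = div≡⊤
  ... | inj₂ (_ , _ , i∈S , j∈S , i≢j , _) = contradiction (2≤∣p∣ i∈S j∈S i≢j) (ℕ.<⇒≱ ∣S∣<2)

  dist-diagonal : ∀ i → d (point i) (point i) ≤ 0#
  dist-diagonal i = ≤-reflexive (≈⇒0 EqC.refl)

  -- The cover has fewer members than T, so two points of T share a centre.
  div-≤-cover : ∀ {r} S T → ∣ S ∣ ℕ.< ∣ T ∣ →
                (∀ i → ∃[ y ] y ∈ S × d (point i) (point y) ≤ r) → div T ≤⁺ [ r + r ]
  div-≤-cover S T ∣S∣<∣T∣ cover
    with i , j , i∈T , j∈T , i≢j , ci≡cj ←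
         subset-pigeonhole T S (proj₁ ∘ cover) (λ {i} _ → proj₁ (proj₂ (cover i))) ∣S∣<∣T∣
    = ≤⁺-trans (div-≤ i∈T j∈T i≢j) AddSupremum.[
        ≤-trans (triangle _ (point (proj₁ (cover i))) _)
          (+-mono-≤ (proj₂ (proj₂ (cover i)))
            (≤-respˡ-≈ (d-sym _ _)
              (subst (λ c → d (point j) (point c) ≤ _) (≡.sym ci≡cj) (proj₂ (proj₂ (cover j)))))) ]

  dmin≤dmax : 2 ℕ.≤ n → dmin ≤⁺ dmax
  dmin≤dmax (s≤s (s≤s _)) = ≤⁺-trans
    (div-≤ {⊤} {Fin.zero} {Fin.suc Fin.zero} ∈⊤ ∈⊤ λ ()) (dist≤dmax _ _)

  module _ (injective : Injective _≡_ (MetricSpace._≈_ M) point) where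

    0<dist : ∀ {i j} → i ≢ j → 0# < d (point i) (point j)
    0<dist i≢j = nonNegative , λ 0≈d → i≢j (injective (0⇒≈ (sym 0≈d)))

    -- The value +∞ is excluded because `dmin` lies below the finite `dmax`. So the minimum is
    -- attained at two distinct indices, which injectivity sends to points at positive distance.
    dmin-positive : 2 ℕ.≤ n → ∃[ δ ] dmin ≡ [ δ ] × 0# < δ
    dmin-positive 2≤n with div-sel ⊤
    ... | inj₁ dmin≡⊤ with () ← subst (λ D → ⊤⁺ ≤⁺ D) (proj₂ dmax-finite)
                                 (subst (_≤⁺ dmax) dmin≡⊤ (dmin≤dmax 2≤n))
    ... | inj₂ (_ , _ , _ , _ , i≢j , dmin≡d) = _ , dmin≡d , 0<dist i≢j

  -- Invariants of one candidate during the pass.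

  module SDMProperties (k : ℕ) (ε : Carrier) where
    open SDM k ε

    -- The test inside `update`, named so that `if-dec-elim` can split an invariant on it.
    accept? : ∀ μ S i → Dec (∣ S ∣ ℕ.< k × μ ≤⁺ distTo i S)
    accept? μ S i = ∣ S ∣ ℕ.<? k ×-dec μ ≤⁺? distTo i S

    Separated : Carrier ⁺ → Subset n → Set _
    Separated μ S = ∀ {i j} → i ∈ S → j ∈ S → i ≢ j → μ ≤⁺ dist i j

    -- Either `i` was stored and is its own centre, or `y` caused its rejection. Keeping the two
    -- apart lets `⊤⊆S0` recover membership in the candidate.
    Near : Carrier ⁺ → Subset n → Fin n → Set _
    Near μ S i = ∃[ y ] y ∈ S × (i ≡ y ⊎ ¬ μ ≤⁺ dist i y)

    module _ {μ : Carrier ⁺} where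

      update-⊇ : ∀ S i → S ⊆ update μ S i
      update-⊇ S i {x} = if-dec-elim (λ S′ → x ∈ S → x ∈ S′) (accept? μ S i)
        (λ _ → p⊆p∪q ⁅ i ⁆) (λ _ x∈S → x∈S)

      update-∣∣≤k : ∀ {S} i → ∣ S ∣ ℕ.≤ k → ∣ update μ S i ∣ ℕ.≤ k
      update-∣∣≤k {S} i ∣S∣≤k = if-dec-elim (λ S′ → ∣ S′ ∣ ℕ.≤ k) (accept? μ S i)
        (λ (∣S∣<k , _) → ℕ.≤-trans (∣p∪⁅x⁆∣≤1+∣p∣ S i) ∣S∣<k) (λ _ → ∣S∣≤k)

      update-separated : ∀ {S} i → Separated μ S → Separated μ (update μ S i)
      update-separated {S} i sep = if-dec-elim (Separated μ) (accept? μ S i) accepted (λ _ → sep)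
        where
        accepted : ∣ S ∣ ℕ.< k × μ ≤⁺ distTo i S → Separated μ (S ∪ ⁅ i ⁆)
        accepted (_ , μ≤) {x} {y} x∈ y∈ x≢y with x∈p∪q⁻ S ⁅ i ⁆ x∈ | x∈p∪q⁻ S ⁅ i ⁆ y∈
        ... | inj₁ x∈S | inj₁ y∈S = sep x∈S y∈S x≢y
        ... | inj₁ x∈S | inj₂ y∈i with ≡.refl ← x∈⁅y⁆⇒x≡y i y∈i =
          dist-sym i x (≤⁺-trans μ≤ (distTo-≤ x∈S))
        ... | inj₂ x∈i | inj₁ y∈S with ≡.refl ← x∈⁅y⁆⇒x≡y i x∈i = ≤⁺-trans μ≤ (distTo-≤ y∈S)
        ... | inj₂ x∈i | inj₂ y∈i =
          contradiction (≡.trans (x∈⁅y⁆⇒x≡y i x∈i) (≡.sym (x∈⁅y⁆⇒x≡y i y∈i))) x≢y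

      -- While there is room, only the distance test can reject `i`, and its failure names a stored
      -- point that is too close.
      update-near : ∀ {S} i → ∣ S ∣ ℕ.< k → Near μ (update μ S i) i
      update-near {S} i ∣S∣<k = if-dec-elim (λ S′ → Near μ S′ i) (accept? μ S i)
        (λ _ → i , q⊆p∪q S ⁅ i ⁆ (x∈⁅x⁆ i) , inj₁ ≡.refl)
        λ rejected → let y , y∈S , μ≰d = distTo-≰ (λ μ≤ → rejected (∣S∣<k , μ≤)) in
                     y , y∈S , inj₂ μ≰d

      fold-⊇ : ∀ S xs → S ⊆ foldl (update μ) S xs
      fold-⊇ S []       x∈S = x∈S
      fold-⊇ S (i ∷ xs) x∈S = fold-⊇ (update μ S i) xs (update-⊇ S i x∈S)

      fold-∣∣≤k : ∀ {S} xs → ∣ S ∣ ℕ.≤ k → ∣ foldl (update μ) S xs ∣ ℕ.≤ k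
      fold-∣∣≤k []       ∣S∣≤k = ∣S∣≤k
      fold-∣∣≤k (i ∷ xs) ∣S∣≤k = fold-∣∣≤k xs (update-∣∣≤k i ∣S∣≤k)

      fold-separated : ∀ {S} xs → Separated μ S → Separated μ (foldl (update μ) S xs)
      fold-separated         []       sep = sep
      fold-separated {S} (i ∷ xs) sep = fold-separated {update μ S i} xs (update-separated {S} i sep)

      -- Candidates only grow: one unfilled at the end had room when `x` arrived, and the centre
      -- found at that moment is still a member.
      fold-near : ∀ S xs → ∣ foldl (update μ) S xs ∣ ℕ.< k →
                  ∀ {x} → x List.∈ xs → Near μ (foldl (update μ) S xs) x
      fold-near S (i ∷ xs) <k (there x∈xs) = fold-near (update μ S i) xs <k x∈xs
      fold-near S (i ∷ xs) <k (here ≡.refl)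
        with y , y∈ , near ← update-near i
               (ℕ.≤-<-trans (p⊆q⇒∣p∣≤∣q∣ (fold-⊇ S (i ∷ xs))) <k)
        = y , fold-⊇ (update μ S i) xs y∈ , near

    candidate-∣∣≤k : ∀ stream μ → ∣ candidate stream μ ∣ ℕ.≤ k
    candidate-∣∣≤k stream μ = fold-∣∣≤k stream (subst (ℕ._≤ k) (≡.sym (∣⊥∣≡0 n)) ℕ.z≤n)

    candidate-div : ∀ stream μ → μ ≤⁺ div (candidate stream μ)
    candidate-div stream μ = div-greatest
      (fold-separated {μ} {⊥} stream (λ i∈⊥ → contradiction i∈⊥ ∉⊥))

  -- Existence of an output and the approximation bound.

  module Approximation
    (injective : Injective _≡_ (MetricSpace._≈_ M) point) (2≤n : 2 ℕ.≤ n)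
    {k : ℕ} (k≤n : k ℕ.≤ n) {ε : Carrier} (0<ε : 0# < ε) (ε<1 : ε < 1#)
    {stream : List (Fin n)} (stream↭ : stream ↭ allFin n)
    where
    open SDM k ε
    open SDMProperties k ε
    open GeometricProgression 0<ε ε<1

    private
      δ D : Carrier
      δ = proj₁ (dmin-positive injective 2≤n)
      D = proj₁ dmax-finite

      dmin≡δ : dmin ≡ [ δ ]
      dmin≡δ = proj₁ (proj₂ (dmin-positive injective 2≤n))

      dmax≡D : dmax ≡ [ D ]
      dmax≡D = proj₂ dmax-finite

      0<δ : 0# < δ
      0<δ = proj₂ (proj₂ (dmin-positive injective 2≤n))

    μ : ℕ → Carrier ⁺
    μ j = dmin /⁺ (1# - ε) ^ j

    S : ℕ → Subset n
    S j = candidate stream (μ j)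

    μ≡level : ∀ j → μ j ≡ [ level δ j ]
    μ≡level j = cong (_/⁺ (1# - ε) ^ j) dmin≡δ

    dmin≤μ : ∀ j → dmin ≤⁺ μ j
    dmin≤μ j rewrite μ≡level j | dmin≡δ = [ δ≤level (proj₁ 0<δ) j ]≤⁺

    μ0≤dmin : μ 0 ≤⁺ dmin
    μ0≤dmin rewrite μ≡level 0 | dmin≡δ = [ ≤-reflexive (level-zero δ) ]≤⁺

    -- The indices that compete in the final argmax; the lower bound required by `𝒰` holds at every
    -- index by `dmin≤μ`.
    Good : ℕ → Set _
    Good j = μ j ≤⁺ dmax × ∣ S j ∣ ≡ k

    good? : Decidable Good
    good? j = μ j ≤⁺? dmax ×-dec ∣ S j ∣ ℕ.≟ k

    near : ∀ j → ∣ S j ∣ ℕ.< k → ∀ i → Near (μ j) (S j) i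
    near j ∣S∣<k i = fold-near ⊥ stream ∣S∣<k (∈-resp-↭ (↭-sym stream↭) (∈-allFin i))

    near⇒d≤level : ∀ j {i y} → i ≡ y ⊎ ¬ μ j ≤⁺ dist i y → d (point i) (point y) ≤ level δ j
    near⇒d≤level j {i} (inj₁ ≡.refl) =
      ≤-trans (dist-diagonal i) (level-nonNegative (proj₁ 0<δ) j)
    near⇒d≤level j {i} {y} (inj₂ μ≰d) with total (d (point i) (point y)) (level δ j)
    ... | inj₁ d≤level = d≤level
    ... | inj₂ level≤d =
      contradiction (subst (_≤⁺ dist i y) (≡.sym (μ≡level j)) [ level≤d ]≤⁺) μ≰d

    -- At the smallest guess a rejected point has already been stored, so a
    -- candidate that never fills up contains all of X.
    ⊤⊆S0 : ∣ S 0 ∣ ℕ.< k → ⊤ ⊆ S 0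
    ⊤⊆S0 ∣S∣<k {i} _ with near 0 ∣S∣<k i
    ... | y , y∈S , inj₁ ≡.refl = y∈S
    ... | y , y∈S , inj₂ μ≰d with i Fin.≟ y
    ...   | yes ≡.refl = y∈S
    ...   | no i≢y     = contradiction (≤⁺-trans μ0≤dmin (div-≤ ∈⊤ ∈⊤ i≢y)) μ≰d

    -- Were the candidate unfilled, it would contain all n points, and n is at least k.
    good-zero : Good 0
    good-zero = ≤⁺-trans μ0≤dmin (dmin≤dmax 2≤n) ,
      ℕ.≤-antisym (candidate-∣∣≤k stream (μ 0)) (ℕ.≮⇒≥ λ ∣S∣<k →
        ℕ.<⇒≱ ∣S∣<k (ℕ.≤-trans k≤n
          (subst (ℕ._≤ ∣ S 0 ∣) (∣⊤∣≡n n) (p⊆q⇒∣p∣≤∣q∣ (⊤⊆S0 ∣S∣<k)))))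

    -- Makes the argmax a finite search and also supplies an index that is not good.
    guesses-bounded : ∃[ N ] ∀ j → μ j ≤⁺ dmax → j ℕ.< N
    guesses-bounded with N , level≰D ← level-unbounded 0<δ D = N , λ j μ≤dmax →
      ℕ.≰⇒> λ N≤j → level≰D (≤-trans (level-mono (proj₁ 0<δ) (ℕ.≤⇒≤′ N≤j)) (level≤D j μ≤dmax))
      where
      level≤D : ∀ j → μ j ≤⁺ dmax → level δ j ≤ D
      level≤D j μ≤dmax rewrite μ≡level j | dmax≡D = [≤]-injective μ≤dmax

    returns : ∃ (Returns stream)
    returns = S best , record
      { μ       = μ best
      ; μ∈𝒰     = guess best (dmin≤μ best) (proj₁ best-good)
      ; S≡Sμ    = ≡.refl
      ; ∣Sμ∣≡k  = proj₂ best-good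
      ; maximal = maximal
      }
      where
      N : ℕ
      N = proj₁ guesses-bounded

      goods : List ℕ
      goods = filter good? (upTo N)

      best : ℕ
      -- The default index 0 is itself good, so the result is good even if the default is returned.
      best = Extrema.argmax totalOrder⁺ (div ∘ S) 0 goods

      best-good : Good best
      best-good = Extrema.argmax-all totalOrder⁺ (div ∘ S) {P = Good} good-zero
        (All.tabulate (λ j∈ → proj₂ (∈-filter⁻ good? {xs = upTo N} j∈)))

      maximal : ∀ {ν} → 𝒰 ν → ∣ candidate stream ν ∣ ≡ k →
                div (candidate stream ν) ≤⁺ div (S best)
      maximal (guess j _ μ≤dmax) ∣Sj∣≡k = All.lookup
        (Extrema.f[xs]≤f[argmax] totalOrder⁺ {f = div ∘ S} 0 goods)
        (∈-filter⁺ good? (∈-upTo⁺ (proj₂ guesses-bounded j μ≤dmax)) (μ≤dmax , ∣Sj∣≡k))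

    -- An index fails to be good in two ways, and each yields a cover of X with fewer than k centres
    -- and radius `level δ j`.
    OPT≤2level : ∀ {j} → 2 ℕ.≤ k → ¬ Good j → OPT k ≤⁺ [ level δ j + level δ j ]
    OPT≤2level {j} 2≤k bad = OPT-≤ (≤-respˡ-≈ (+-identityˡ 0#) (+-mono-≤ 0≤level 0≤level)) bound
      where
      0≤level : 0# ≤ level δ j
      0≤level = level-nonNegative (proj₁ 0<δ) j

      bound : ∀ T → ∣ T ∣ ≡ k → div T ≤⁺ [ level δ j + level δ j ]
      bound T ∣T∣≡k with μ j ≤⁺? dmax
      ... | yes μ≤dmax = div-≤-cover (S j) T (subst (∣ S j ∣ ℕ.<_) (≡.sym ∣T∣≡k) ∣S∣<k) λ i →
        let y , y∈S , i~y = near j ∣S∣<k i in y , y∈S , near⇒d≤level j i~y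
        where
        ∣S∣<k : ∣ S j ∣ ℕ.< k
        ∣S∣<k = ℕ.≤∧≢⇒< (candidate-∣∣≤k stream (μ j)) (λ ∣S∣≡k → bad (μ≤dmax , ∣S∣≡k))
      -- A guess above `dmax` exceeds all distances, so any single point covers X; `2 ℕ.≤ k` makes
      -- that one centre fewer than k.
      ... | no μ≰dmax = div-≤-cover ⁅ centre ⁆ T
        (subst₂ ℕ._<_ (≡.sym (∣⁅x⁆∣≡1 centre)) (≡.sym ∣T∣≡k) 2≤k)
        λ i → centre , x∈⁅x⁆ centre ,
              near⇒d≤level j (inj₂ λ μ≤d → μ≰dmax (≤⁺-trans μ≤d (dist≤dmax i centre)))
        where
        centre : Fin n
        centre = Fin.fromℕ< (ℕ.≤-trans (s≤s ℕ.z≤n) 2≤n)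

    approximation : 2 ℕ.≤ k → ∀ {S′} → Returns stream S′ →
                    ((1# - ε) / 2#) ·⁺ OPT k ≤⁺ div S′
    approximation 2≤k ret
      -- Index 0 is good and the bound `N` is not, so goodness is lost between some j and its
      -- successor.
      with j , (μ≤dmax , ∣Sj∣≡k) , bad ← last-before-failure good? good-zero
             (proj₁ guesses-bounded) (λ (μ≤dmax , _) → ℕ.<-irrefl ≡.refl (proj₂ guesses-bounded _ μ≤dmax))
      = begin
      -- The optimum is bounded at the failing successor; the factor (1 - ε)/2 then cancels both the
      -- doubling and the one extra step of the progression.
      ((1# - ε) / 2#) ·⁺ OPT k          ≤⟨ ·⁺-≤ 0≤a/2 (OPT≤2level {suc j} 2≤k bad) ⟩
      [ (1# - ε) / 2# * (L + L) ]       ≤⟨ [ ≤-reflexive a/2*2L≈level ]≤⁺ ⟩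
      [ level δ j ]                     ≡⟨ μ≡level j ⟨
      μ j                               ≤⟨ candidate-div stream (μ j) ⟩
      div (S j)                         ≤⟨ Returns.maximal ret (guess j (dmin≤μ j) μ≤dmax) ∣Sj∣≡k ⟩
      div (candidate stream (Returns.μ ret)) ≡⟨ cong div (Returns.S≡Sμ ret) ⟨
      div _                             ∎
      where
      open ≤-Reasoning (DecTotalOrder.poset decTotalOrder⁺)
      L = level δ (suc j)

      0≤a/2 : 0# ≤ (1# - ε) / 2#
      0≤a/2 = *-nonNegative 0≤a (⁻¹-nonNegative (≤-trans 0≤1 1≤2) 2≉0)

      a/2*2L≈level : (1# - ε) / 2# * (L + L) ≈ level δ j
      a/2*2L≈level = trans (x/2*[y+y]≈x*y (1# - ε) L) (a*level-suc δ j)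

-- Existence of an output is claimed for at least two points: with a single point `dmin` is +∞ while
-- `dmax` is finite, so `𝒰` is empty and there is no candidate to return.
theorem1 : ∀ {c ℓ₁ ℓ₂ m ℓ : Level}
    (K : ArchimedeanOrderedField c ℓ₁ ℓ₂) (M : MetricSpace K m ℓ)
    (let open ArchimedeanOrderedField K) (let open Extended K)
    (n : ℕ) (point : Fin n → MetricSpace.Carrier M) →
    Injective _≡_ (MetricSpace._≈_ M) point →
    (k : ℕ) → 1 ℕ.≤ k → k ℕ.≤ n →
    (ε : Carrier) → 0# < ε → ε < 1# →
    (stream : List (Fin n)) → stream ↭ allFin n →
    (let open Diversity K M point) (let open SDM k ε) →
    (2 ℕ.≤ n → ∃ (Returns stream)) ×
    (∀ (S : Subset n) → Returns stream S →
    (∣ S ∣ ≡ k) × (((1# - ε) / 2#) ·⁺ OPT k ≤⁺ div S))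
theorem1 K M n point injective k 1≤k k≤n ε 0<ε ε<1 stream stream↭ =
  (λ 2≤n → Approximation.returns injective 2≤n k≤n 0<ε ε<1 stream↭) ,
  λ S ret → ∣S∣≡k S ret , bound S ret
  where
  open ArchimedeanOrderedField K using (1#; _/_; 2#) renaming (_-_ to _-ᴷ_)
  open Extended K
  open Diversity K M point
  open DiversityProperties K M point
  open SDM k ε

  ∣S∣≡k : ∀ S → Returns stream S → ∣ S ∣ ≡ k
  ∣S∣≡k S ret = ≡.trans (cong ∣_∣ (Returns.S≡Sμ ret)) (Returns.∣Sμ∣≡k ret)

  bound : ∀ S → Returns stream S → ((1# -ᴷ ε) / 2#) ·⁺ OPT k ≤⁺ div S
  bound S ret with ℕ.<-≤-connex k 2
  -- A set of fewer than two points has diversity +∞, which dominates whatever the left side is.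
  ... | inj₁ k<2 rewrite div-small {S} (subst (ℕ._< 2) (≡.sym (∣S∣≡k S ret)) k<2) = _ ≤⊤⁺
  ... | inj₂ 2≤k = Approximation.approximation injective (ℕ.≤-trans 2≤k k≤n) k≤n 0<ε ε<1 stream↭ 2≤k ret
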